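{- Let $m,\ell\geq 2$ and let $n\ge 1$ be divisible by $\ell$. Then \[a_{2(\ell)}(n)=b_\ell(2n,n),\] and more generally \[a_{m(\ell)}(n)=a_{(m-1)(\ell)}(2n,n).\]
   Context: An $\ell$-regular partition is a partition with no part divisible by $\ell$. $a_{m(\ell)}(n)$ is the number of $\ell$-regular partitions of $n$ in which the smallest part occurs at least $m$ times. $a_{m(\ell)}(N,k)$ is the number of $\ell$-regular partitions of $N$ in which the smallest part occurs at least $m$ times and the largest part minus the smallest part equals $k$. $b_\ell(N,k)$ is the number of $\ell$-regular partitions of $N$ in which the largest part minus the smallest part equals $k$. -}

module Defs where

open import Data.List using (List; []; _∷_; _++_; map; filter; length)
open import Data.List.Extrema.Nat using (min; max)
open import Data.List.Membership.Propositional using (_∈_)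
open import Data.List.Membership.Propositional.Properties
  using (∈-map⁺; ∈-map⁻; ∈-++⁺ˡ; ∈-++⁺ʳ; ∈-++⁻)
open import Data.List.Properties using (∷-injectiveʳ)
open import Data.List.Relation.Unary.All as All using (All; []; _∷_)
open import Data.List.Relation.Unary.AllPairs using ([]; _∷_)
open import Data.List.Relation.Unary.Any using (here)
open import Data.List.Relation.Unary.Linked as Linked using (Linked; []; [-]; _∷_)
open import Data.List.Relation.Unary.Linked.Properties using (Linked⇒AllPairs)
open import Data.List.Relation.Unary.Unique.Propositional using (Unique)
import Data.List.Relation.Unary.Unique.Propositional.Properties as Unique
open import Data.Nat using (ℕ; zero; suc; _+_; _∸_; _≤_; _<_; _≥_; z≤n; s≤s; _≟_; _≤?_)
open import Data.Nat.Divisibility using (_∣_; _∣?_)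
open import Data.Nat.ListAction using (sum)
open import Data.Nat.Properties
open import Data.Product using (_×_; _,_)
open import Data.Sum using (inj₁; inj₂)
open import Function using (_⇔_; mk⇔)
open import Level using (0ℓ)
open import Relation.Binary.PropositionalEquality using (_≡_; refl; sym; trans; cong; subst)
open import Relation.Nullary using (¬_; yes; no; contradiction; ¬?; _×-dec_)
open import Relation.Unary using (Pred; Decidable)

record IsPartition (n : ℕ) (xs : List ℕ) : Set where
  constructor isPartition
  field
    parts-positive : All (0 <_) xs
    parts-sorted   : Linked _≥_ xs
    parts-sum      : sum xs ≡ n

-- boundedPartitions f k n lists the partitions of n with all parts at most k.
-- The argument f is fuel for the termination checker; f ≥ k + n suffices.
boundedPartitions : ℕ → ℕ → ℕ → List (List ℕ)
boundedPartitions _       _       zero    = [] ∷ []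
boundedPartitions _       zero    (suc n) = []
boundedPartitions zero    (suc k) (suc n) = []
boundedPartitions (suc f) (suc k) (suc n) with k ≤? n
... | yes _ = boundedPartitions f k (suc n)
              ++ map (suc k ∷_) (boundedPartitions f (suc k) (n ∸ k))
... | no  _ = boundedPartitions f k (suc n)

-- Every partition of n exactly once: see ∈-partitions and partitions-unique.
partitions : ℕ → List (List ℕ)
partitions n = boundedPartitions (n + n) n n

numberOfPartitions : {P : Pred (List ℕ) 0ℓ} → Decidable P → ℕ → ℕ
numberOfPartitions P? n = length (filter P? (partitions n))

Regular : ℕ → Pred (List ℕ) 0ℓ
Regular ℓ = All (λ p → ¬ ℓ ∣ p)

regular? : ∀ ℓ → Decidable (Regular ℓ)
regular? ℓ = All.all? (λ p → ¬? (ℓ ∣? p))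

-- The values of smallest and largest at [] (the partition of 0) are arbitrary.
smallest : List ℕ → ℕ
smallest []       = 0
smallest (x ∷ xs) = min x xs

largest : List ℕ → ℕ
largest = max 0

multiplicity : ℕ → List ℕ → ℕ
multiplicity p xs = length (filter (p ≟_) xs)

SmallestAtLeast : ℕ → Pred (List ℕ) 0ℓ
SmallestAtLeast m xs = m ≤ multiplicity (smallest xs) xs

smallestAtLeast? : ∀ m → Decidable (SmallestAtLeast m)
smallestAtLeast? m xs = m ≤? multiplicity (smallest xs) xs

Difference : ℕ → Pred (List ℕ) 0ℓ
Difference k xs = largest xs ∸ smallest xs ≡ k

difference? : ∀ k → Decidable (Difference k)
difference? k xs = largest xs ∸ smallest xs ≟ k

a : (m ℓ n : ℕ) → ℕ
a m ℓ = numberOfPartitions λ xs → regular? ℓ xs ×-dec smallestAtLeast? m xs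

-- The two-argument a_{m(ℓ)}(N,k).
a₂ : (m ℓ N k : ℕ) → ℕ
a₂ m ℓ N k = numberOfPartitions
  (λ xs → regular? ℓ xs ×-dec (smallestAtLeast? m xs ×-dec difference? k xs)) N

b : (ℓ N k : ℕ) → ℕ
b ℓ N k = numberOfPartitions (λ xs → regular? ℓ xs ×-dec difference? k xs) N

private
  cons-sorted : ∀ {k xs} → All (_≤ k) xs → Linked _≥_ xs → Linked _≥_ (k ∷ xs)
  cons-sorted []       []  = [-]
  cons-sorted (p ∷ _)  lxs = p ∷ lxs

  sorted-bounded : ∀ {x xs} → Linked _≥_ (x ∷ xs) → All (_≤ x) xs
  sorted-bounded l with Linked⇒AllPairs (λ p q → ≤-trans q p) l
  ... | px ∷ _ = px

  part≤sum : ∀ xs → All (_≤ sum xs) xs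
  part≤sum []       = []
  part≤sum (x ∷ xs) =
    m≤m+n x (sum xs) ∷ All.map (λ p → ≤-trans p (m≤n+m (sum xs) x)) (part≤sum xs)

  sound : ∀ f k n {xs} → xs ∈ boundedPartitions f k n → IsPartition n xs × All (_≤ k) xs
  sound _       _       zero    (here refl) = isPartition [] [] refl , []
  sound (suc f) (suc k) (suc n) xs∈ with k ≤? n
  ... | no _ with sound f k (suc n) xs∈
  ...   | ip , b≤ = ip , All.map m≤n⇒m≤1+n b≤
  sound (suc f) (suc k) (suc n) xs∈ | yes k≤n
    with ∈-++⁻ (boundedPartitions f k (suc n)) xs∈
  ... | inj₁ p with sound f k (suc n) p
  ...   | ip , b≤ = ip , All.map m≤n⇒m≤1+n b≤
  sound (suc f) (suc k) (suc n) xs∈ | yes k≤n | inj₂ p with ∈-map⁻ (suc k ∷_) p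
  ... | ys , ys∈ , refl with sound f (suc k) (n ∸ k) ys∈
  ...   | isPartition pos srt s , b≤ =
          isPartition (s≤s z≤n ∷ pos) (cons-sorted b≤ srt)
            (cong suc (trans (cong (k +_) s) (m+[n∸m]≡n k≤n)))
          , ≤-refl ∷ b≤

  complete : ∀ f k n {xs} → k + n ≤ f → IsPartition n xs → All (_≤ k) xs →
             xs ∈ boundedPartitions f k n
  complete f k zero {[]} _ _ _ = here refl
  complete f k zero {zero ∷ xs} _ (isPartition (() ∷ _) _ _) _
  complete f k (suc n) {[]} _ (isPartition _ _ ()) _
  complete f zero (suc n) {x ∷ xs} _ (isPartition (0<x ∷ _) _ _) (x≤0 ∷ _) =
    contradiction (≤-trans 0<x x≤0) λ ()
  complete (suc f) (suc k) (suc n) {x ∷ xs} (s≤s k+n≤f) ip@(isPartition (_ ∷ pos) srt s) (x≤ ∷ b≤)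
    with k ≤? n | x ≤? k
  ... | yes _ | yes x≤k = ∈-++⁺ˡ (complete f k (suc n) k+n≤f ip
                            (x≤k ∷ All.map (λ p → ≤-trans p x≤k) (sorted-bounded srt)))
  ... | no _ | yes x≤k = complete f k (suc n) k+n≤f ip
                            (x≤k ∷ All.map (λ p → ≤-trans p x≤k) (sorted-bounded srt))
  ... | k≤?n | no x≰k with ≤-antisym x≤ (≰⇒> x≰k)
  complete (suc f) (suc k) (suc n) {x ∷ xs} (s≤s k+n≤f) (isPartition (_ ∷ pos) srt s) (x≤ ∷ b≤)
      | no k≰n | no _ | refl =
        contradiction (subst (k ≤_) (suc-injective s) (m≤m+n k (sum xs))) k≰n
  complete (suc f) (suc k) (suc n) {x ∷ xs} (s≤s k+n≤f) (isPartition (_ ∷ pos) srt s) (x≤ ∷ b≤)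
      | yes k≤n | no _ | refl =
        ∈-++⁺ʳ (boundedPartitions f k (suc n)) (∈-map⁺ (suc k ∷_)
          (complete f (suc k) (n ∸ k)
            (≤-trans (s≤s (+-monoʳ-≤ k (m∸n≤m n k)))
                     (subst (_≤ f) (+-suc k n) k+n≤f))
            (isPartition pos (Linked.tail srt)
              (trans (sym (m+n∸m≡n k (sum xs))) (cong (_∸ k) (suc-injective s))))
            b≤))

  unique : ∀ f k n → Unique (boundedPartitions f k n)
  unique _       _       zero    = [] ∷ []
  unique _       zero    (suc n) = []
  unique zero    (suc k) (suc n) = []
  unique (suc f) (suc k) (suc n) with k ≤? n
  ... | no  _ = unique f k (suc n)
  ... | yes _ = Unique.++⁺ (unique f k (suc n))
                  (Unique.map⁺ ∷-injectiveʳ (unique f (suc k) (n ∸ k)))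
                  disjoint
    where
    disjoint : ∀ {xs} →
      ¬ (xs ∈ boundedPartitions f k (suc n) ×
         xs ∈ map (suc k ∷_) (boundedPartitions f (suc k) (n ∸ k)))
    disjoint (p , q) with ∈-map⁻ (suc k ∷_) q
    ... | _ , _ , refl with sound f k (suc n) p
    ...   | _ , (1+k≤k ∷ _) = 1+n≰n 1+k≤k

∈-partitions : ∀ {n xs} → xs ∈ partitions n ⇔ IsPartition n xs
∈-partitions {n} {xs} = mk⇔
  (λ p → let ip , _ = sound (n + n) n n p in ip)
  (λ ip → complete (n + n) n n ≤-refl ip
     (subst (λ s → All (_≤ s) xs) (IsPartition.parts-sum ip) (part≤sum xs)))

partitions-unique : ∀ n → Unique (partitions n)
partitions-unique n = unique (n + n) n n

{-# OPTIONS --safe #-}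
-- Replace one copy of the smallest part s of a partition of n by the part n + s.
-- The result is a partition of 2n with largest part n + s; if s occurred at least
-- twice, its smallest part is still s, with multiplicity one less, and so the
-- difference is n. Conversely, a partition of 2n with difference n ≥ 1 and
-- smallest part s has largest part n + s, which can be lowered to s. As ℓ ∣ n, one
-- of s and n + s is divisible by ℓ exactly when the other is.
module Submission where

open import Defs
open import Data.List using (List; []; _∷_; _++_; _∷ʳ_; map; filter; length; _∷ʳ′_; initLast)
open import Data.List.Extrema.Nat using (min≤v⁺; v≤min⁺; min≤⊤; min≤xs; max≈v⁺; argmin-sel)
open import Data.List.Membership.Propositional using (_∈_; lose)
open import Data.List.Membership.Propositional.Properties
  using (∈-map∘filter⁺; ∈-map∘filter⁻; ∈-filter⁺; ∈-filter⁻; ∈-++⁺ʳ)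
open import Data.List.Membership.Propositional.Properties.WithK using (unique∧set⇒bag)
open import Data.List.Properties
  using (length-map; length-++; filter-++; filter-≐; filter-accept; filter-reject; filter-some;
         ∷ʳ-injective; ∷-injective)
open import Data.List.Relation.Binary.BagAndSetEquality using (∼bag⇒↭)
open import Data.List.Relation.Binary.Permutation.Propositional.Properties using (↭-length)
open import Data.List.Relation.Unary.All as All using (All; []; _∷_)
import Data.List.Relation.Unary.All.Properties as All
open import Data.List.Relation.Unary.AllPairs using (AllPairs; []; _∷_)
import Data.List.Relation.Unary.AllPairs.Properties as AllPairs
open import Data.List.Relation.Unary.Any using (here; there)
open import Data.List.Relation.Unary.Linked using (Linked)
open import Data.List.Relation.Unary.Linked.Properties using (Linked⇒AllPairs; AllPairs⇒Linked)
import Data.List.Relation.Unary.Unique.Propositional.Properties as Unique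
open import Data.Nat using (ℕ; suc; _+_; _*_; _∸_; _≤_; _≥_; z≤n; s≤s; _≟_)
open import Data.Nat.Divisibility using (_∣_; ∣m+n∣m⇒∣n)
open import Data.Nat.ListAction using (sum)
open import Data.Nat.ListAction.Properties using (sum-++)
open import Data.Nat.Properties
open import Data.Product using (_×_; _,_; ∃; ∃₂)
open import Data.Sum using (inj₁; inj₂)
open import Function using (_∘_; id; flip; mk⇔; Equivalence)
open import Function.Definitions using (Injective)
open import Level using (Level; 0ℓ)
open import Relation.Binary using (Rel)
open import Relation.Binary.PropositionalEquality
open import Relation.Nullary using (contradiction)
open import Relation.Unary using (Pred; Decidable)

private
  variable
    c r : Level
    A : Set c

-- Counting partitions along a bijection.

-- Both filtered lists are free of repetitions, and mapping along an injective `f` preserves this as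
-- well as the length. By `to` and `from` the image list and the second list have the same members,
-- so they are permutations of each other.
numberOfPartitions-bijection :
  ∀ {P Q : Pred (List ℕ) 0ℓ} (P? : Decidable P) (Q? : Decidable Q) {n n′} (f : List ℕ → List ℕ) →
  Injective _≡_ _≡_ f →
  (∀ {xs} → IsPartition n xs → P xs → IsPartition n′ (f xs) × Q (f xs)) →
  (∀ {ys} → IsPartition n′ ys → Q ys → ∃ λ xs → IsPartition n xs × ys ≡ f xs × P xs) →
  numberOfPartitions P? n ≡ numberOfPartitions Q? n′
numberOfPartitions-bijection P? Q? {n} {n′} f f-injective to from = begin
  length (filter P? (partitions n))          ≡⟨ length-map f (filter P? (partitions n)) ⟨
  length (map f (filter P? (partitions n)))  ≡⟨ ↭-length (∼bag⇒↭ (unique∧set⇒bag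
    (Unique.map⁺ f-injective (Unique.filter⁺ P? (partitions-unique n)))
    (Unique.filter⁺ Q? (partitions-unique n′))
    (mk⇔ image⊆ ⊆image))) ⟩
  length (filter Q? (partitions n′))         ∎
  where
  open ≡-Reasoning
  open Equivalence using () renaming (to to ⇒; from to ⇐)

  image⊆ : ∀ {ys} → ys ∈ map f (filter P? (partitions n)) → ys ∈ filter Q? (partitions n′)
  image⊆ ys∈ with ∈-map∘filter⁻ f P? ys∈
  ... | xs , xs∈ , refl , Pxs with to (⇒ ∈-partitions xs∈) Pxs
  ...   | part , Qfxs = ∈-filter⁺ Q? (⇐ ∈-partitions part) Qfxs

  ⊆image : ∀ {ys} → ys ∈ filter Q? (partitions n′) → ys ∈ map f (filter P? (partitions n))
  ⊆image ys∈ with ∈-filter⁻ Q? {xs = partitions n′} ys∈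
  ... | ys∈′ , Qys with from (⇒ ∈-partitions ys∈′) Qys
  ...   | xs , part , eq , Pxs = ∈-map∘filter⁺ f P? (xs , ⇐ ∈-partitions part , eq , Pxs)

-- The map on lists of parts.

[]≢∷ʳ : ∀ xs {x : A} → [] ≢ xs ∷ʳ x
[]≢∷ʳ []      ()
[]≢∷ʳ (_ ∷ _) ()

-- In a partition the last entry is the smallest part. The value at `[]` keeps the map injective on
-- all lists, since nonempty lists have nonempty images.
rotate : ℕ → List ℕ → List ℕ
rotate n xs with initLast xs
... | []       = []
... | ys ∷ʳ′ s = n + s ∷ ys

rotate-∷ʳ : ∀ n ys s → rotate n (ys ∷ʳ s) ≡ n + s ∷ ys
rotate-∷ʳ n ys s = rotate-≡ refl
  where
  -- `initLast` is stuck on `ys ∷ʳ s` for a variable `ys`, so the list is generalised to `xs` with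
  -- an equation before matching.
  rotate-≡ : ∀ {xs} → xs ≡ ys ∷ʳ s → rotate n xs ≡ n + s ∷ ys
  rotate-≡ {xs} eq with initLast xs
  ... | []       = contradiction eq ([]≢∷ʳ ys)
  ... | zs ∷ʳ′ t with refl , refl ← ∷ʳ-injective zs ys eq = refl

rotate-injective : ∀ n → Injective _≡_ _≡_ (rotate n)
rotate-injective n {xs} {ys} eq with initLast xs | initLast ys
... | []       | []       = refl
... | us ∷ʳ′ s | vs ∷ʳ′ t with n+s≡n+t , us≡vs ← ∷-injective eq =
  cong₂ _∷ʳ_ us≡vs (+-cancelˡ-≡ n s t n+s≡n+t)

-- Order, sums, extreme parts and multiplicities.

AllPairs-∷ʳ⁻ : ∀ {R : Rel A r} xs {x} → AllPairs R (xs ∷ʳ x) → AllPairs R xs × All (flip R x) xs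
AllPairs-∷ʳ⁻ []       _          = [] , []
AllPairs-∷ʳ⁻ (y ∷ ys) (py ∷ pys) with All.∷ʳ⁻ py | AllPairs-∷ʳ⁻ ys pys
... | py′ , Ryx | pys′ , Rysx = py′ ∷ pys′ , Ryx ∷ Rysx

-- `AllPairs` compares the last part with every earlier one, as is needed to split off or append a
-- smallest part.
sorted⇒AllPairs : ∀ {xs} → Linked _≥_ xs → AllPairs _≥_ xs
sorted⇒AllPairs = Linked⇒AllPairs (flip ≤-trans)

sum-∷ʳ : ∀ xs x → sum (xs ∷ʳ x) ≡ sum xs + x
sum-∷ʳ xs x = trans (sum-++ xs (x ∷ [])) (cong (sum xs +_) (+-identityʳ x))

All-≤-sum : ∀ xs → All (_≤ sum xs) xs
All-≤-sum []       = []
All-≤-sum (x ∷ xs) = m≤m+n x (sum xs) ∷ All.map (m≤n⇒m≤o+n x) (All-≤-sum xs)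

smallest-≡ : ∀ {s xs} → s ∈ xs → All (s ≤_) xs → smallest xs ≡ s
smallest-≡ {xs = x ∷ xs} (here refl) (s≤x ∷ s≤xs) =
  ≤-antisym (min≤v⁺ x xs (inj₁ ≤-refl)) (v≤min⁺ s≤x s≤xs)
smallest-≡ {xs = x ∷ xs} (there s∈)  (s≤x ∷ s≤xs) =
  ≤-antisym (min≤v⁺ x xs (inj₂ (lose s∈ ≤-refl))) (v≤min⁺ s≤x s≤xs)

smallest-∈ : ∀ x xs → smallest (x ∷ xs) ∈ x ∷ xs
smallest-∈ x xs with argmin-sel id x xs
... | inj₁ eq = here eq
... | inj₂ ∈xs = there ∈xs

largest-head : ∀ {x xs} → All (_≤ x) xs → largest (x ∷ xs) ≡ x
largest-head xs≤x = max≈v⁺ (here refl) (≤-refl ∷ xs≤x) z≤n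

multiplicity-∷ʳ : ∀ s xs → multiplicity s (xs ∷ʳ s) ≡ suc (multiplicity s xs)
multiplicity-∷ʳ s xs = begin
  length (filter (s ≟_) (xs ∷ʳ s))
    ≡⟨ cong length (filter-++ (s ≟_) xs (s ∷ [])) ⟩
  length (filter (s ≟_) xs ++ filter (s ≟_) (s ∷ []))
    ≡⟨ length-++ (filter (s ≟_) xs) ⟩
  multiplicity s xs + length (filter (s ≟_) (s ∷ []))
    ≡⟨ cong (λ ys → multiplicity s xs + length ys) (filter-accept (s ≟_) refl) ⟩
  multiplicity s xs + 1
    ≡⟨ +-comm (multiplicity s xs) 1 ⟩
  suc (multiplicity s xs)
    ∎
  where open ≡-Reasoning

multiplicity-∷-≢ : ∀ {p x} xs → p ≢ x → multiplicity p (x ∷ xs) ≡ multiplicity p xs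
multiplicity-∷-≢ {p} xs p≢x = cong length (filter-reject (p ≟_) p≢x)

length-positive⇒∃∈ : ∀ {xs : List A} → 1 ≤ length xs → ∃ (_∈ xs)
length-positive⇒∃∈ {xs = x ∷ _} _ = x , here refl

multiplicity-positive⇒∈ : ∀ {p} xs → 1 ≤ multiplicity p xs → p ∈ xs
multiplicity-positive⇒∈ {p} xs pos with length-positive⇒∃∈ pos
... | q , q∈ with ∈-filter⁻ (p ≟_) {xs = xs} q∈
...   | q∈xs , refl = q∈xs

-- The two directions of the correspondence.

module _ {ℓ n : ℕ} (1≤n : 1 ≤ n) where

  s≢n+s : ∀ {s} → s ≢ n + s
  s≢n+s {s} = <⇒≢ (m<n+m s 1≤n)

  -- At least `m ≥ 1` copies of `s` remain in `ys`, so `s` is still the smallest part and the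
  -- difference is `(n + s) ∸ s`.
  raiseSmallest : ∀ {m ys s} → ℓ ∣ n → 1 ≤ m → IsPartition n (ys ∷ʳ s) →
    Regular ℓ (ys ∷ʳ s) × SmallestAtLeast (suc m) (ys ∷ʳ s) →
    IsPartition (2 * n) (n + s ∷ ys) ×
    Regular ℓ (n + s ∷ ys) × SmallestAtLeast m (n + s ∷ ys) × Difference n (n + s ∷ ys)
  raiseSmallest {m} {ys} {s} ℓ∣n 1≤m (isPartition pos srt Σ≡n) (reg , atLeast)
    with AllPairs-∷ʳ⁻ ys (sorted⇒AllPairs srt) | All.∷ʳ⁻ pos | All.∷ʳ⁻ reg
  ... | srt-ys , s≤ys | pos-ys , 0<s | reg-ys , ℓ∤s =
      isPartition (m≤n⇒m≤o+n n 0<s ∷ pos-ys) (AllPairs⇒Linked (ys≤n+s ∷ srt-ys)) Σ≡2n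
    , (ℓ∤s ∘ flip ∣m+n∣m⇒∣n ℓ∣n) ∷ reg-ys
    , subst (m ≤_) (sym (trans (cong (λ p → multiplicity p (n + s ∷ ys)) smallest≡s)
                               (multiplicity-∷-≢ ys s≢n+s))) m≤mult
    , trans (cong₂ _∸_ (largest-head ys≤n+s) smallest≡s) (m+n∸n≡m n s)
    where
    open ≡-Reasoning

    Σys+s≡n : sum ys + s ≡ n
    Σys+s≡n = trans (sym (sum-∷ʳ ys s)) Σ≡n

    ys≤n+s : All (_≤ n + s) ys
    -- Each remaining part is at most `sum ys ≤ n`, so `n + s` can stand in front.
    ys≤n+s = All.map
      (λ y≤Σ → ≤-trans y≤Σ (≤-trans (m≤m+n (sum ys) s) (≤-trans (≤-reflexive Σys+s≡n) (m≤m+n n s))))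
      (All-≤-sum ys)

    Σ≡2n : n + s + sum ys ≡ 2 * n
    Σ≡2n = begin
      n + s + sum ys    ≡⟨ +-assoc n s (sum ys) ⟩
      n + (s + sum ys)  ≡⟨ cong (n +_) (trans (+-comm s (sum ys)) Σys+s≡n) ⟩
      n + n             ≡⟨ cong (n +_) (+-identityʳ n) ⟨
      2 * n             ∎

    m≤mult : m ≤ multiplicity s ys
    m≤mult = ≤-pred (subst (suc m ≤_)
      (trans (cong (λ p → multiplicity p (ys ∷ʳ s))
                   (smallest-≡ (∈-++⁺ʳ ys (here refl)) (All.∷ʳ⁺ s≤ys ≤-refl)))
             (multiplicity-∷ʳ s ys))
      atLeast)

    smallest≡s : smallest (n + s ∷ ys) ≡ s
    smallest≡s = smallest-≡ (there (multiplicity-positive⇒∈ ys (≤-trans 1≤m m≤mult)))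
                            (m≤n+m s n ∷ s≤ys)

  -- The largest part `y` equals `n + s` and so differs from `s`; hence `s` occurs in `ys`. The
  -- appended copy of `s` inherits positivity and regularity from that occurrence.
  lowerLargest : ∀ {m zs} → IsPartition (2 * n) zs →
    Regular ℓ zs × SmallestAtLeast m zs × Difference n zs →
    ∃₂ λ ys s → zs ≡ n + s ∷ ys ×
    IsPartition n (ys ∷ʳ s) × Regular ℓ (ys ∷ʳ s) × SmallestAtLeast (suc m) (ys ∷ʳ s)
  -- By the default values at `[]`, its difference is 0, which is not `n`.
  lowerLargest {zs = []} _ (_ , _ , 0≡n) = contradiction (subst (1 ≤_) (sym 0≡n) 1≤n) λ ()
  lowerLargest {m} {y ∷ ys} (isPartition (0<y ∷ pos) srt Σ≡2n) (ℓ∤y ∷ reg , atLeast , diff)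
    with sorted⇒AllPairs srt
  ... | ys≤y ∷ srt-ys =
      ys , s , cong (_∷ ys) y≡n+s
    , isPartition (All.∷ʳ⁺ pos (All.lookup pos s∈ys))
        (AllPairs⇒Linked (AllPairs.++⁺ srt-ys ([] ∷ []) (All.map (_∷ []) s≤ys)))
        (trans (sum-∷ʳ ys s) Σys+s≡n)
    , All.∷ʳ⁺ reg (All.lookup reg s∈ys)
    , subst (suc m ≤_)
        (sym (trans (cong (λ p → multiplicity p (ys ∷ʳ s))
                          (smallest-≡ (∈-++⁺ʳ ys (here refl)) (All.∷ʳ⁺ s≤ys ≤-refl)))
                    (multiplicity-∷ʳ s ys)))
        -- The head `y` contributes no copy of `s`, and the appended `s` supplies the extra one.
        (s≤s (subst (m ≤_) (multiplicity-∷-≢ ys s≢y) atLeast))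
    where
    open ≡-Reasoning

    s : ℕ
    s = smallest (y ∷ ys)

    s≤ys : All (s ≤_) ys
    s≤ys = min≤xs y ys

    y≡n+s : y ≡ n + s
    y≡n+s = begin
      y                         ≡⟨ m∸n+n≡m (min≤⊤ y ys) ⟨
      y ∸ s + s                 ≡⟨ cong (λ x → x ∸ s + s) (largest-head ys≤y) ⟨
      largest (y ∷ ys) ∸ s + s  ≡⟨ cong (_+ s) diff ⟩
      n + s                     ∎

    s≢y : s ≢ y
    s≢y s≡y = s≢n+s (trans s≡y y≡n+s)

    s∈ys : s ∈ ys
    s∈ys with smallest-∈ y ys
    ... | here s≡y = contradiction s≡y s≢y
    ... | there s∈ = s∈

    Σys+s≡n : sum ys + s ≡ n
    Σys+s≡n = +-cancelˡ-≡ n (sum ys + s) n (begin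
      n + (sum ys + s)  ≡⟨ cong (n +_) (+-comm (sum ys) s) ⟩
      n + (s + sum ys)  ≡⟨ +-assoc n s (sum ys) ⟨
      n + s + sum ys    ≡⟨ cong (_+ sum ys) y≡n+s ⟨
      y + sum ys        ≡⟨ Σ≡2n ⟩
      2 * n             ≡⟨ cong (n +_) (+-identityʳ n) ⟩
      n + n             ∎)

-- The two identities.

a-suc : ∀ {m ℓ n} → 1 ≤ m → 1 ≤ n → ℓ ∣ n → a (suc m) ℓ n ≡ a₂ m ℓ (2 * n) n
a-suc {m} {ℓ} {n} 1≤m 1≤n ℓ∣n =
  numberOfPartitions-bijection _ _ (rotate n) (rotate-injective n) to from
  where
  to : ∀ {xs} → IsPartition n xs → Regular ℓ xs × SmallestAtLeast (suc m) xs →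
       IsPartition (2 * n) (rotate n xs) ×
       Regular ℓ (rotate n xs) × SmallestAtLeast m (rotate n xs) × Difference n (rotate n xs)
  to {xs} part good with initLast xs
  ... | []       = contradiction (subst (1 ≤_) (sym (IsPartition.parts-sum part)) 1≤n) λ ()
  ... | ys ∷ʳ′ s = raiseSmallest 1≤n ℓ∣n 1≤m part good

  from : ∀ {zs} → IsPartition (2 * n) zs →
         Regular ℓ zs × SmallestAtLeast m zs × Difference n zs →
         ∃ λ xs → IsPartition n xs × zs ≡ rotate n xs × Regular ℓ xs × SmallestAtLeast (suc m) xs
  from part good with lowerLargest 1≤n part good
  ... | ys , s , refl , part′ , good′ = ys ∷ʳ s , part′ , sym (rotate-∷ʳ n ys s) , good′

-- The smallest part of a nonempty partition occurs at least once, and `1 ≤ k` excludes `[]`, whose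
-- difference is 0.
a₂-1≡b : ∀ ℓ N {k} → 1 ≤ k → a₂ 1 ℓ N k ≡ b ℓ N k
a₂-1≡b ℓ N {k} 1≤k = cong length (filter-≐ _ _
  ( (λ (reg , _ , diff) → reg , diff)
  , (λ {xs} (reg , diff) → reg , atLeastOnce xs diff , diff)) (partitions N))
  where
  atLeastOnce : ∀ xs → Difference k xs → SmallestAtLeast 1 xs
  atLeastOnce []       0≡k = contradiction (subst (1 ≤_) (sym 0≡k) 1≤k) λ ()
  atLeastOnce (x ∷ xs) _   = filter-some (smallest (x ∷ xs) ≟_) (smallest-∈ x xs)

theorem5p5 : (m ℓ n : ℕ) → 2 ≤ m → 2 ≤ ℓ → 1 ≤ n → ℓ ∣ n →
    (a 2 ℓ n ≡ b ℓ (2 * n) n) × (a m ℓ n ≡ a₂ (m ∸ 1) ℓ (2 * n) n)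
theorem5p5 (suc m) ℓ n (s≤s 1≤m) _ 1≤n ℓ∣n =
  -- The first identity is `a-suc` with multiplicity bound 1 on the right, where that bound holds
  -- automatically.
  trans (a-suc ≤-refl 1≤n ℓ∣n) (a₂-1≡b ℓ (2 * n) 1≤n) , a-suc 1≤m 1≤n ℓ∣n
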